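{- Let $k\ge1$, let $x\in\tilde S_{k+1}$ be an affine permutation, and let $\alpha$ be the $k$-code obtained from the maximal decomposition of $x$ into cyclically decreasing elements. Let $\mathfrak Q$ be the set of recording tableaux associated to $\alpha$, i.e. the set of all $Q(w)$ where $w$ runs over the reduced words (of affine permutations in $\tilde S_{k+1}$) whose insertion is the $k$-code $\alpha$. Then $\mathfrak Q$ is in bijection, via $w\mapsto Q(w)$, with the set of reduced words for $x$.
   Context: Fix $k\ge1$, $I=\mathbb Z/(k+1)\mathbb Z$. $\tilde S_{k+1}$ is the affine symmetric group with simple generators $s_i$ ($i\in I$). The affine nil-Coxeter monoid is generated by $a_i$ ($i\in I$) and an absorbing zero, with relations $a_i^2=0$, $a_ia_j=a_ja_i$ for $j\notin\{i-1,i,i+1\}$, and (for $k\ge2$) $a_ia_{i+1}a_i=a_{i+1}a_ia_{i+1}$; its nonzero elements are identified with affine permutations via reduced words. For $A\subsetneq I$, $d_A$ is the product of the $a_i$, $i\in A$, each once, with $a_j$ left of $a_{j-1}$ whenever $j,j-1\in A$. Every affine permutation has a unique decomposition $x=d_{A_n}\cdots d_{A_1}$ ($A_i\subsetneq I$ nonempty) whose shape $(|A_1|,\dots,|A_n|)$ is lexicographically maximal, and it satisfies $A_{j+1}\subset A_j-1:=\{s-1:s\in A_j\}$. A $k$-code is a function $\alpha:I\to\mathbb Z_{\ge0}$ with at least one zero value. Its diagram lives on a cylinder with columns indexed by $I$; column $i$ has $\alpha_i$ boxes, in rows $1,\dots,\alpha_i$ (row 1 at the bottom); in the filling, the box in column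 $i$ and row $j$ carries residue $i-(j-1)$. The $k$-code of $x$ is the $\alpha$ whose filling has in row $j$ exactly the residues in $A_j$. Insertion of a residue $p$ into a filling with rows $A_1,A_2,\dots$ (with $A_j=\emptyset$ beyond the last row): start with $j=1$ and the residue $p$, and repeat: (Inclusion) if $p-1,p\notin A_j$: put $p$ into $A_j$ and halt. (Bump) if $p\notin A_j$ and $p-1\in A_j$: remove $p-1$ from $A_j$, put $p$ into $A_j$, and continue by inserting $p-1$ into row $j+1$. (Braid) if $p\in A_j$ and $p-1\in A_j$: leave $A_j$ unchanged and continue by inserting $p-1$ into row $j+1$. (If $p\in A_j$ and $p-1\notin A_j$ the product is zero; this does not occur for reduced words.) The insertion of a reduced word $w=[w_1,\dots,w_n]$ is the filling obtained by inserting $w_1$, then $w_2$, ..., then $w_n$, starting from the empty filling. The recording tableau $Q(w)$ is the labelling of the boxes of the resulting diagram by $1,\dots,n$ produced as follows: when the $j$-th letter is inserted, the box finally added by the Inclusion step is labelled $j$; whenever a Bump move replaces the box of residue $p-1$ in a row by the box of residue $p$ in that row, the label of the removed box is transferred to the new box. -}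

module Defs where

open import Algebra.Bundles using (Group)
open import Data.Fin.Base using (Fin; zero; suc; fromℕ; inject₁)
open import Data.Fin.Subset using (Subset; _∈_; ⊤; ⊥; _⊂_; Nonempty; ∣_∣)
open import Data.List.Base as List using (List; []; _∷_; _++_; [_]; length; reverse)
open import Data.List.Properties using (++-assoc; ++-identityʳ; unfold-reverse; reverse-++)
import Data.List.Membership.Propositional as ListMembership
open import Data.List.Relation.Binary.Lex.Strict using (Lex-≤)
open import Data.List.Relation.Unary.All using (All)
open import Data.List.Relation.Unary.AllPairs using (AllPairs)
open import Data.Maybe.Base as Maybe using (Maybe; just; nothing; is-just; fromMaybe; _>>=_)
open import Data.Nat.Base using (ℕ; zero; suc; _≤_; _<_)
open import Data.Product.Base using (∃-syntax; _×_; _,_; proj₁)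
open import Data.Vec.Base as Vec using (Vec; lookup; replicate; _[_]≔_)
open import Function.Bundles using (_⇔_)
open import Level using (0ℓ)
open import Relation.Binary.Bundles using (Setoid)
open import Relation.Binary.PropositionalEquality using (_≡_; _≢_; _≗_; refl; setoid; _→-setoid_)
import Relation.Binary.PropositionalEquality as ≡
import Relation.Binary.Construct.On as On

-- ℤ/(k+1)ℤ
I : ℕ → Set
I k = Fin (suc k)

-- i ↦ i - 1 in ℤ/(k+1)ℤ
pred : ∀ {k} → I k → I k
pred {k} zero    = fromℕ k
pred     (suc i) = inject₁ i

-- i ↦ i - j in ℤ/(k+1)ℤ
_⊖_ : ∀ {k} → I k → ℕ → I k
i ⊖ zero  = i
i ⊖ suc j = pred i ⊖ j

------------------------------------------------------------------------
-- The affine symmetric group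

Word : ℕ → Set
Word k = List (I k)

infix 4 _≈_

-- Equality in the Coxeter group: since every generator is an involution,
-- words in the generators represent all elements.
data _≈_ {k : ℕ} : Word k → Word k → Set where
  ≈-refl     : ∀ {u} → u ≈ u
  ≈-sym      : ∀ {u v} → u ≈ v → v ≈ u
  ≈-trans    : ∀ {u v w} → u ≈ v → v ≈ w → u ≈ w
  ++-cong    : ∀ {u u′ v v′} → u ≈ u′ → v ≈ v′ → u ++ v ≈ u′ ++ v′
  involution : ∀ i → i ∷ i ∷ [] ≈ []
  -- j ∉ {i - 1, i, i + 1}
  commute    : ∀ i j → j ≢ pred i → j ≢ i → pred j ≢ i →
               i ∷ j ∷ [] ≈ j ∷ i ∷ []
  -- For k = 1 the two generators satisfy no braid relation.
  braid      : 2 ≤ k → ∀ i →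
               pred i ∷ i ∷ pred i ∷ [] ≈ i ∷ pred i ∷ i ∷ []

module _ {k : ℕ} where

  ≡⇒≈ : {u v : Word k} → u ≡ v → u ≈ v
  ≡⇒≈ refl = ≈-refl

  reverse-inverseˡ : (u : Word k) → reverse u ++ u ≈ []
  reverse-inverseˡ []      = ≈-refl
  reverse-inverseˡ (i ∷ u) =
    ≈-trans (≡⇒≈ (≡.trans (≡.cong (_++ i ∷ u) (unfold-reverse i u))
                          (++-assoc (reverse u) [ i ] (i ∷ u))))
    (≈-trans (++-cong (≈-refl {u = reverse u}) (++-cong (involution i) (≈-refl {u = u})))
             (reverse-inverseˡ u))

  reverse-inverseʳ : (u : Word k) → u ++ reverse u ≈ []
  reverse-inverseʳ []      = ≈-refl
  reverse-inverseʳ (i ∷ u) =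
    ≈-trans (≡⇒≈ (≡.trans (≡.cong ((i ∷ u) ++_) (unfold-reverse i u))
                          (≡.cong (i ∷_) (≡.sym (++-assoc u (reverse u) [ i ])))))
    (≈-trans (++-cong (≈-refl {u = [ i ]}) (++-cong (reverse-inverseʳ u) (≈-refl {u = [ i ]})))
             (involution i))

  reverse-cong : {u v : Word k} → u ≈ v → reverse u ≈ reverse v
  reverse-cong ≈-refl              = ≈-refl
  reverse-cong (≈-sym p)           = ≈-sym (reverse-cong p)
  reverse-cong (≈-trans p q)       = ≈-trans (reverse-cong p) (reverse-cong q)
  reverse-cong (++-cong {u} {u′} {v} {v′} p q) =
    ≈-trans (≡⇒≈ (reverse-++ u v))
    (≈-trans (++-cong (reverse-cong q) (reverse-cong p))
             (≡⇒≈ (≡.sym (reverse-++ u′ v′))))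
  reverse-cong (involution i)      = involution i
  reverse-cong (commute i j a b c) = ≈-sym (commute i j a b c)
  reverse-cong (braid 2≤k i)       = braid 2≤k i

AffineSymmetricGroup : ℕ → Group 0ℓ 0ℓ
AffineSymmetricGroup k = record
  { Carrier = Word k
  ; _≈_     = _≈_
  ; _∙_     = _++_
  ; ε       = []
  ; _⁻¹     = reverse
  ; isGroup = record
    { isMonoid = record
      { isSemigroup = record
        { isMagma = record
          { isEquivalence = record { refl = ≈-refl ; sym = ≈-sym ; trans = ≈-trans }
          ; ∙-cong        = ++-cong
          }
        ; assoc = λ u v w → ≡⇒≈ (++-assoc u v w)
        }
      ; identity = (λ _ → ≈-refl) , (λ u → ≡⇒≈ (++-identityʳ u))
      }
    ; inverse = reverse-inverseˡ , reverse-inverseʳ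
    ; ⁻¹-cong = reverse-cong
    }
  }

AffinePermutation : ℕ → Set
AffinePermutation k = Group.Carrier (AffineSymmetricGroup k)

Reduced : ∀ {k} → Word k → Set
Reduced w = ∀ v → v ≈ w → length w ≤ length v

ReducedWordFor : ∀ {k} → AffinePermutation k → Word k → Set
ReducedWordFor x w = w ≈ x × Reduced w

ReducedWords : ∀ {k} → AffinePermutation k → Setoid 0ℓ 0ℓ
ReducedWords {k} x = On.setoid (setoid (Word k)) (proj₁ {B = ReducedWordFor x})

------------------------------------------------------------------------
-- Cyclically decreasing decompositions

-- The word w spells d_A.  For letters a before b, the condition a ≢ b makes
-- each letter occur once, and a ≢ pred b forces j to the left of j - 1.
_Spells-d_ : ∀ {k} → Word k → Subset (suc k) → Set
w Spells-d A =
  AllPairs (λ a b → a ≢ b × a ≢ pred b) w × (∀ i → i ListMembership.∈ w ⇔ i ∈ A)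

-- Lists of subsets run A₁, A₂, …, Aₙ; the word spells d_{Aₙ} ⋯ d_{A₁}.
data SpellsProduct {k : ℕ} : List (Subset (suc k)) → Word k → Set where
  []  : SpellsProduct [] []
  _∷_ : ∀ {A As u v} → u Spells-d A → SpellsProduct As v →
        SpellsProduct (A ∷ As) (v ++ u)

-- The product d_{Aₙ} ⋯ d_{A₁} is taken in the nil-Coxeter monoid, where it is
-- the (nonzero) element x exactly when its word is a reduced word for x.
Decomposition : ∀ {k} → AffinePermutation k → List (Subset (suc k)) → Set
Decomposition x As =
  All (λ A → Nonempty A × A ⊂ ⊤) As ×
  ∃[ w ] SpellsProduct As w × ReducedWordFor x w

shape : ∀ {k} → List (Subset (suc k)) → List ℕ
shape = List.map ∣_∣

MaximalDecomposition : ∀ {k} → AffinePermutation k → List (Subset (suc k)) → Set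
MaximalDecomposition x As =
  Decomposition x As ×
  (∀ Bs → Decomposition x Bs → Lex-≤ _≡_ _<_ (shape Bs) (shape As))

------------------------------------------------------------------------
-- Codes (rows are numbered from 0 instead of 1)

record Code (k : ℕ) : Set where
  field
    height  : I k → ℕ
    hasZero : ∃[ i ] height i ≡ 0

open Code public

row : ∀ {n} → List (Subset n) → ℕ → Subset n
row []       j       = ⊥
row (A ∷ As) zero    = A
row (A ∷ As) (suc j) = row As j

-- Row j of the filling of α carries exactly the residues in row As j.
IsFillingOf : ∀ {k} → List (Subset (suc k)) → Code k → Set
IsFillingOf As α =
  ∀ j p → p ∈ row As j ⇔ (∃[ i ] j < height α i × i ⊖ j ≡ p)

IsCodeOf : ∀ {k} → Code k → AffinePermutation k → Set
IsCodeOf α x = ∃[ As ] MaximalDecomposition x As × IsFillingOf As α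

------------------------------------------------------------------------
-- Insertion and recording tableaux

-- A row A ⊆ I in which every box carries a label: residue p lies in A when
-- its entry is  just ℓ,  where ℓ is the label.
LabelledRow : ℕ → Set
LabelledRow k = Vec (Maybe ℕ) (suc k)

LabelledFilling : ℕ → Set
LabelledFilling k = List (LabelledRow k)

∅ : ∀ {k} → LabelledRow k
∅ = replicate _ nothing

residues : ∀ {k} → LabelledFilling k → List (Subset (suc k))
residues = List.map (Vec.map is-just)

-- Insert residue p with label ℓ; the auxiliary function receives the entries
-- of residues p and p - 1 in the current row.  The result is nothing when
-- the product is zero.
mutual
  insert : ∀ {k} → ℕ → I k → LabelledFilling k → Maybe (LabelledFilling k)
  insert ℓ p []      = just ((∅ [ p ]≔ just ℓ) ∷ [])
  insert ℓ p (A ∷ F) = insertRow ℓ p A F (lookup A p) (lookup A (pred p))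

  insertRow : ∀ {k} → ℕ → I k → LabelledRow k → LabelledFilling k →
              Maybe ℕ → Maybe ℕ → Maybe (LabelledFilling k)
  -- Inclusion
  insertRow ℓ p A F nothing  nothing  = just ((A [ p ]≔ just ℓ) ∷ F)
  -- Bump
  insertRow ℓ p A F nothing  (just m) =
    Maybe.map (((A [ pred p ]≔ nothing) [ p ]≔ just m) ∷_) (insert ℓ (pred p) F)
  -- Braid
  insertRow ℓ p A F (just _) (just _) = Maybe.map (A ∷_) (insert ℓ (pred p) F)
  -- Zero
  insertRow ℓ p A F (just _) nothing  = nothing

insertWord : ∀ {k} → ℕ → Word k → LabelledFilling k → Maybe (LabelledFilling k)
insertWord ℓ []      F = just F
insertWord ℓ (p ∷ w) F = insert ℓ p F >>= insertWord (suc ℓ) w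

insertion : ∀ {k} → Word k → Maybe (LabelledFilling k)
insertion w = insertWord 1 w []

InsertsTo : ∀ {k} → Word k → Code k → Set
InsertsTo w α = ∃[ F ] insertion w ≡ just F × IsFillingOf (residues F) α

-- A labelling of boxes (column , row) of the cylinder; positions outside the
-- diagram are sent to nothing.
Tableau : ℕ → Set
Tableau k = I k × ℕ → Maybe ℕ

labelledRow : ∀ {k} → LabelledFilling k → ℕ → LabelledRow k
labelledRow []      j       = ∅
labelledRow (A ∷ F) zero    = A
labelledRow (A ∷ F) (suc j) = labelledRow F j

labels : ∀ {k} → LabelledFilling k → Tableau k
labels F (i , j) = lookup (labelledRow F j) (i ⊖ j)

-- The default [] is only reached by words whose insertion is zero.
Q : ∀ {k} → Word k → Tableau k
Q w = labels (fromMaybe [] (insertion w))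

IsRecordingTableauOf : ∀ {k} → Code k → Tableau k → Set
IsRecordingTableauOf α T = ∃[ w ] Reduced w × InsertsTo w α × T ≗ Q w

RecordingTableaux : ∀ {k} → Code k → Setoid 0ℓ 0ℓ
RecordingTableaux {k} α =
  On.setoid ((I k × ℕ) →-setoid Maybe ℕ) (proj₁ {B = IsRecordingTableauOf α})

{-# OPTIONS --safe #-}
module Submission where

-- Seen on columns, inserting p only touches the heights a, b of columns p - 1
-- and p: it turns (a , b) into (b , a + 1) if b ≤ a and gives zero otherwise.
-- Completed by (a , b) ↦ (b - 1 , a) for a < b, this is an action of the affine
-- symmetric group on height functions (the action on Lehmer codes).  A word that
-- spells the decomposition with heights α sends 0 to α.  An exchange argument
-- shows that the stabiliser of 0 is trivial and that the reduced words are
-- insertable, so the reduced words with insertion α are those of x.  A recording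
-- tableau determines its word because the largest label sits in the column of
-- the last letter, and the slide of that insertion can be undone.

open import Defs
open import Data.Bool.Base using (Bool; true; false; if_then_else_)
open import Data.Bool.Properties using (T-≡)
open import Data.Fin.Base using (zero; suc; inject₁; toℕ)
open import Data.Fin.Properties
  using (_≟_; toℕ-inject₁; inject₁-injective; fromℕ≢inject₁)
open import Data.Fin.Relation.Unary.Top using (view; ‵fromℕ; ‵inject₁)
open import Data.Fin.Subset using (Subset; _∈_)
open import Data.Fin.Subset.Properties using (∉⊥)
open import Data.List.Base using (List; []; _∷_; _++_; [_]; length)
import Data.List.Membership.Propositional as ListMembership
open import Data.List.Properties using (++-assoc; ++-identityʳ; length-++)
open import Data.List.Relation.Unary.All as All using ([]; _∷_)
open import Data.List.Relation.Unary.AllPairs using (AllPairs; []; _∷_)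
open import Data.List.Relation.Unary.Any using (here; there)
open import Data.Maybe.Base using (Maybe; just; nothing; is-just; _<∣>_)
open import Data.Nat.Base
  using (ℕ; zero; suc; _+_; _∸_; _≤_; _<_; _<ᵇ_; _≡ᵇ_; z≤n; s≤s; NonZero; ≢-nonZero⁻¹)
open import Data.Nat.Properties
  using (≤-trans; ≤-refl; ≤-antisym; <-irrefl; <-trans; <-≤-trans; <⇒≱; ≰⇒>; ≮⇒≥; _≤?_; n≤1+n;
         m<n⇒m<1+n; m≢1+n+m; <ᵇ⇒<; <⇒<ᵇ; ≡⇒≡ᵇ; +-comm; +-monoʳ-≤; ∸-monoˡ-≤; suc-injective)
open import Data.Product.Base using (Σ-syntax; ∃-syntax; _×_; _,_; proj₁; proj₂)
open import Data.Vec.Base using (lookup; _[_]≔_)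
open import Data.Vec.Properties
  using (lookup∘update; lookup∘update′; lookup-replicate; lookup-map; []=⇒lookup; lookup⇒[]=)
open import Function.Base using (_∘_)
open import Function.Bundles using (Bijection; _⇔_; Equivalence; mk⇔)
open import Relation.Binary.PropositionalEquality
  using (_≡_; _≢_; _≗_; refl; sym; trans; cong; cong₂; subst; subst₂)
open import Relation.Nullary using (¬_; does; yes; no; contradiction)
open import Relation.Nullary.Decidable using (dec-true; dec-false)

open Equivalence using () renaming (to to ⇒; from to ⇐)

-- Residues modulo k + 1

pred-injective : ∀ {k} {i j : I k} → pred i ≡ pred j → i ≡ j
pred-injective {i = zero}  {zero}  _  = refl
pred-injective {i = zero}  {suc j} eq = contradiction eq fromℕ≢inject₁
pred-injective {i = suc i} {zero}  eq = contradiction (sym eq) fromℕ≢inject₁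
pred-injective {i = suc i} {suc j} eq = cong suc (inject₁-injective eq)

next : ∀ {k} → I k → I k
next i with view i
... | ‵fromℕ     = zero
... | ‵inject₁ j = suc j

pred-next : ∀ {k} (i : I k) → pred (next i) ≡ i
pred-next i with view i
... | ‵fromℕ     = refl
... | ‵inject₁ j = refl

next-pred : ∀ {k} (i : I k) → next (pred i) ≡ i
next-pred i = pred-injective (pred-next (pred i))

⊖-injective : ∀ {k} (j : ℕ) {i i′ : I k} → i ⊖ j ≡ i′ ⊖ j → i ≡ i′
⊖-injective zero    eq = eq
⊖-injective (suc j) eq = pred-injective (⊖-injective j eq)

⊖-surjective : ∀ {k} (j : ℕ) (p : I k) → ∃[ i ] i ⊖ j ≡ p
⊖-surjective zero    p = p , refl
⊖-surjective (suc j) p with ⊖-surjective j p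
... | i , eq = next i , trans (cong (_⊖ j) (pred-next i)) eq

pred≢id : ∀ {k} .{{_ : NonZero k}} (p : I k) → pred p ≢ p
pred≢id {zero}  p       = contradiction refl (≢-nonZero⁻¹ 0)
pred≢id {suc k} zero    = λ ()
pred≢id {suc k} (suc i) = λ eq →
  m≢1+n+m (toℕ i) (trans (sym (toℕ-inject₁ i)) (cong toℕ eq))

-- For `k` at most 1, stepping back twice returns to the start. Through this lemma a strict chain of
-- heights yields the side condition of `braid`.
pred²≢id⇒2≤k : ∀ {k} {p : I k} → pred (pred p) ≢ p → 2 ≤ k
pred²≢id⇒2≤k {zero}        {zero}     ne = contradiction refl ne
pred²≢id⇒2≤k {suc zero}    {zero}     ne = contradiction refl ne
pred²≢id⇒2≤k {suc zero}    {suc zero} ne = contradiction refl ne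
pred²≢id⇒2≤k {suc (suc k)}            ne = s≤s (s≤s z≤n)

2≤k⇒pred²≢id : ∀ {k} → 2 ≤ k → (p : I k) → pred (pred p) ≢ p
2≤k⇒pred²≢id (s≤s (s≤s _)) zero          = λ ()
2≤k⇒pred²≢id (s≤s (s≤s _)) (suc zero)    = λ ()
2≤k⇒pred²≢id (s≤s (s≤s _)) (suc (suc i)) = λ eq →
  m≢1+n+m (toℕ i) (trans (sym (trans (toℕ-inject₁ (inject₁ i)) (toℕ-inject₁ i))) (cong toℕ eq))

-- The action on column heights

-- The boxes common to all columns are split off recursively, which makes
-- swap-braid hold almost definitionally; swap-≤ and swap-> give the values.
swap : ℕ → ℕ → ℕ × ℕ
swap a       zero    = 0 , suc a
swap zero    (suc b) = b , 0
swap (suc a) (suc b) = let x , y = swap a b in suc x , suc y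

swap-≤ : ∀ {a b} → b ≤ a → swap a b ≡ (b , suc a)
swap-≤ z≤n = refl
swap-≤ (s≤s b≤a) rewrite swap-≤ b≤a = refl

swap-> : ∀ {a b} → a < b → swap a b ≡ (b ∸ 1 , a)
swap-> {zero}  {suc b}       _         = refl
swap-> {suc a} {suc (suc b)} (s≤s a<b) rewrite swap-> a<b = refl

swap-involutive : ∀ a b → swap (proj₁ (swap a b)) (proj₂ (swap a b)) ≡ (a , b)
swap-involutive a       zero    = refl
swap-involutive zero    (suc b) = refl
swap-involutive (suc a) (suc b) rewrite swap-involutive a b = refl

swapˡ swapʳ : ℕ × ℕ × ℕ → ℕ × ℕ × ℕ
swapˡ (a , b , c) = let x , y = swap a b in x , y , c
swapʳ (a , b , c) = a , swap b c

swap-braid : ∀ a b c → swapˡ (swapʳ (swapˡ (a , b , c))) ≡ swapʳ (swapˡ (swapʳ (a , b , c)))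
swap-braid a       b       zero    = refl
swap-braid a       zero    (suc c) = refl
swap-braid zero    (suc b) (suc c) = refl
swap-braid (suc a) (suc b) (suc c) =
  cong (λ (x , y , z) → suc x , suc y , suc z) (swap-braid a b c)

Heights : ℕ → Set
Heights k = I k → ℕ

Descent : ∀ {k} → I k → Heights k → Set
Descent p β = β (pred p) < β p

opaque
  -- Kept opaque so that `reflect` stays folded in later goals; everything after this block goes
  -- through the equations for column `p`, column `pred p` and the other columns.
  reflect : ∀ {k} → I k → Heights k → Heights k
  reflect p β i =
    if does (i ≟ p) then proj₂ (swap (β (pred p)) (β p)) else
    if does (i ≟ pred p) then proj₁ (swap (β (pred p)) (β p)) else β i

  reflect-cong : ∀ {k} (p : I k) {β γ : Heights k} → β ≗ γ → reflect p β ≗ reflect p γ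
  reflect-cong p eq i rewrite eq (pred p) | eq p | eq i = refl

  reflect-self : ∀ {k} (p : I k) β → reflect p β p ≡ proj₂ (swap (β (pred p)) (β p))
  reflect-self p β rewrite dec-true (p ≟ p) refl = refl

  reflect-other : ∀ {k} (p : I k) β {i} → i ≢ p → i ≢ pred p → reflect p β i ≡ β i
  reflect-other p β {i} i≢p i≢p-1
    rewrite dec-false (i ≟ p) i≢p | dec-false (i ≟ pred p) i≢p-1 = refl

  reflect-pred : ∀ {k} .{{_ : NonZero k}} (p : I k) β →
                 reflect p β (pred p) ≡ proj₁ (swap (β (pred p)) (β p))
  reflect-pred p β
    rewrite dec-false (pred p ≟ p) (pred≢id p) | dec-true (pred p ≟ pred p) refl = refl

data Position {k} (p i : I k) : Set where
  self : i ≡ p → Position p i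
  left : i ≡ pred p → Position p i
  away : i ≢ p → i ≢ pred p → Position p i

position : ∀ {k} (p i : I k) → Position p i
position p i with i ≟ p | i ≟ pred p
... | yes eq | _      = self eq
... | no _   | yes eq = left eq
... | no ne  | no ne′ = away ne ne′

-- The first letter acts first, in the order in which letters are inserted.
act : ∀ {k} → Word k → Heights k → Heights k
act []      β = β
act (p ∷ w) β = act w (reflect p β)

act-cong : ∀ {k} (w : Word k) {β γ : Heights k} → β ≗ γ → act w β ≗ act w γ
act-cong []      eq = eq
act-cong (p ∷ w) eq = act-cong w (reflect-cong p eq)

act-++ : ∀ {k} (u v : Word k) (β : Heights k) → act (u ++ v) β ≡ act v (act u β)
act-++ []      v β = refl
act-++ (p ∷ u) v β = act-++ u v (reflect p β)

Descent-resp-≗ : ∀ {k} (p : I k) {β γ : Heights k} → β ≗ γ → Descent p β → Descent p γ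
Descent-resp-≗ p eq d = subst₂ _<_ (eq (pred p)) (eq p) d

module _ {k : ℕ} .{{_ : NonZero k}} where

  reflect-involutive : (p : I k) (β : Heights k) → reflect p (reflect p β) ≗ β
  reflect-involutive p β i with position p i
  ... | self refl =
    trans (reflect-self p _)
    (trans (cong₂ (λ a b → proj₂ (swap a b)) (reflect-pred p β) (reflect-self p β))
          (cong proj₂ (swap-involutive (β (pred p)) (β p))))
  ... | left refl =
    trans (reflect-pred p _)
    (trans (cong₂ (λ a b → proj₁ (swap a b)) (reflect-pred p β) (reflect-self p β))
          (cong proj₁ (swap-involutive (β (pred p)) (β p))))
  ... | away i≢p i≢p-1 =
    trans (reflect-other p _ i≢p i≢p-1) (reflect-other p β i≢p i≢p-1)

  -- The hypotheses say that the column pairs `pred p`, `p` and `pred q`, `q` are disjoint, so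
  -- neither reflection reads or changes what the other one does.
  reflect-commute : (p q : I k) → q ≢ pred p → q ≢ p → pred q ≢ p → (β : Heights k) →
                    reflect p (reflect q β) ≗ reflect q (reflect p β)
  reflect-commute p q q≢p-1 q≢p q-1≢p β i with position p i | position q i
  ... | self refl | self refl = contradiction refl q≢p
  ... | self refl | left refl = contradiction refl q-1≢p
  ... | left refl | self refl = contradiction refl q≢p-1
  ... | left refl | left eq   = contradiction (sym (pred-injective eq)) q≢p
  ... | away a b  | away c d  = trans
    (trans (reflect-other p _ a b) (reflect-other q β c d))
    (sym (trans (reflect-other q _ c d) (reflect-other p β a b)))
  ... | away a b  | self refl
    rewrite reflect-other p (reflect q β) a b | reflect-self q (reflect p β) | reflect-self q β
          | reflect-other p β q≢p q≢p-1
          | reflect-other p β q-1≢p (q≢p ∘ pred-injective) = refl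
  ... | away a b  | left refl
    rewrite reflect-other p (reflect q β) a b | reflect-pred q (reflect p β) | reflect-pred q β
          | reflect-other p β q≢p q≢p-1
          | reflect-other p β q-1≢p (q≢p ∘ pred-injective) = refl
  ... | self refl | away c d
    rewrite reflect-other q (reflect p β) c d | reflect-self p (reflect q β) | reflect-self p β
          | reflect-other q β c d
          | reflect-other q β (q≢p-1 ∘ sym) (q≢p ∘ sym ∘ pred-injective) = refl
  ... | left refl | away c d
    rewrite reflect-other q (reflect p β) c d | reflect-pred p (reflect q β) | reflect-pred p β
          | reflect-other q β c d
          | reflect-other q β (q≢p ∘ sym) (q-1≢p ∘ sym) = refl

  -- Follows the three columns on which `reflect p` and `reflect (pred p)` act, so that the braid
  -- relation on height functions becomes the identity `swap-braid` on triples of numbers.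
  record Triple (p : I k) (β γ : Heights k) (t : ℕ × ℕ × ℕ) : Set where
    constructor triple
    field
      low  : γ (pred (pred p)) ≡ proj₁ t
      mid  : γ (pred p) ≡ proj₁ (proj₂ t)
      high : γ p ≡ proj₂ (proj₂ t)
      rest : ∀ {i} → i ≢ p → i ≢ pred p → i ≢ pred (pred p) → γ i ≡ β i

  open Triple

  Triple-unique : ∀ {p β γ δ t} → Triple p β γ t → Triple p β δ t → γ ≗ δ
  Triple-unique {p} G D i with i ≟ p | i ≟ pred p | i ≟ pred (pred p)
  ... | yes refl | _ | _ = trans (high G) (sym (high D))
  ... | no _ | yes refl | _ = trans (mid G) (sym (mid D))
  ... | no _ | no _ | yes refl = trans (low G) (sym (low D))
  ... | no a | no b | no c = trans (rest G a b c) (sym (rest D a b c))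

  module _ (2≤k : 2 ≤ k) (p : I k) where

    Triple-self : ∀ {β γ t} → Triple p β γ t → Triple p β (reflect p γ) (swapʳ t)
    Triple-self {β} {γ} {a , b , c} G = triple
      (trans (reflect-other p γ (2≤k⇒pred²≢id 2≤k p) (pred≢id (pred p))) (low G))
      (trans (reflect-pred p γ) (cong₂ (λ x y → proj₁ (swap x y)) (mid G) (high G)))
      (trans (reflect-self p γ) (cong₂ (λ x y → proj₂ (swap x y)) (mid G) (high G)))
      (λ i≢p i≢p-1 i≢p-2 → trans (reflect-other p γ i≢p i≢p-1) (rest G i≢p i≢p-1 i≢p-2))

    Triple-pred : ∀ {β γ t} → Triple p β γ t → Triple p β (reflect (pred p) γ) (swapˡ t)
    Triple-pred {β} {γ} {a , b , c} G = triple
      (trans (reflect-pred (pred p) γ) (cong₂ (λ x y → proj₁ (swap x y)) (low G) (mid G)))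
      (trans (reflect-self (pred p) γ) (cong₂ (λ x y → proj₂ (swap x y)) (low G) (mid G)))
      (trans (reflect-other (pred p) γ (pred≢id p ∘ sym) (2≤k⇒pred²≢id 2≤k p ∘ sym)) (high G))
      (λ i≢p i≢p-1 i≢p-2 → trans (reflect-other (pred p) γ i≢p-1 i≢p-2) (rest G i≢p i≢p-1 i≢p-2))

    reflect-braid : (β : Heights k) →
      reflect (pred p) (reflect p (reflect (pred p) β)) ≗ reflect p (reflect (pred p) (reflect p β))
    reflect-braid β = Triple-unique
      (subst (Triple p β _) (swap-braid (β (pred (pred p))) (β (pred p)) (β p))
             (Triple-pred (Triple-self (Triple-pred start))))
      (Triple-self (Triple-pred (Triple-self start)))
      where
      start : Triple p β β (β (pred (pred p)) , β (pred p) , β p)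
      start = triple refl refl refl (λ _ _ _ → refl)

  act-resp-≈ : {u v : Word k} → u ≈ v → (β : Heights k) → act u β ≗ act v β
  act-resp-≈ ≈-refl          β i = refl
  act-resp-≈ (≈-sym e)       β i = sym (act-resp-≈ e β i)
  act-resp-≈ (≈-trans e f)   β i = trans (act-resp-≈ e β i) (act-resp-≈ f β i)
  act-resp-≈ (++-cong {u} {u′} {v} {v′} e f) β i
    rewrite act-++ u v β | act-++ u′ v′ β =
    trans (act-cong v (act-resp-≈ e β) i) (act-resp-≈ f (act u′ β) i)
  act-resp-≈ (involution p)  β i = reflect-involutive p β i
  act-resp-≈ (commute p q a b c) β i = sym (reflect-commute p q a b c β i)
  act-resp-≈ (braid 2≤k p)   β i = reflect-braid 2≤k p β i

  -- Words that raise the heights, and the exchange property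

  Ascent : I k → Heights k → Set
  Ascent p β = β p ≤ β (pred p)

  reflect-Descent-self : ∀ (p : I k) (β : Heights k) → Descent p β → reflect p β p ≡ β (pred p)
  reflect-Descent-self p β d = trans (reflect-self p β) (cong proj₂ (swap-> d))

  reflect-Descent-pred : ∀ (p : I k) (β : Heights k) → Descent p β → reflect p β (pred p) ≡ β p ∸ 1
  reflect-Descent-pred p β d = trans (reflect-pred p β) (cong proj₁ (swap-> d))

  reflect-Ascent-self : ∀ (p : I k) (β : Heights k) → Ascent p β → reflect p β p ≡ suc (β (pred p))
  reflect-Ascent-self p β a = trans (reflect-self p β) (cong proj₂ (swap-≤ a))

  reflect-Ascent-pred : ∀ (p : I k) (β : Heights k) → Ascent p β → reflect p β (pred p) ≡ β p
  reflect-Ascent-pred p β a = trans (reflect-pred p β) (cong proj₁ (swap-≤ a))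

  Ascent⇒Descent : ∀ (p : I k) (β : Heights k) → Ascent p β → Descent p (reflect p β)
  Ascent⇒Descent p β a =
    subst₂ _<_ (sym (reflect-Ascent-pred p β a)) (sym (reflect-Ascent-self p β a)) (s≤s a)

  -- The first index is the length of the word; it drives the recursion in exchange.
  data Builds : ℕ → Word k → Heights k → Set where
    empty : ∀ {β} → β ≗ (λ _ → 0) → Builds 0 [] β
    snoc  : ∀ {n u p β} → Descent p β → Builds n u (reflect p β) →
            Builds (suc n) (u ++ [ p ]) β

  Builds-resp-≗ : ∀ {n u β γ} → β ≗ γ → Builds n u β → Builds n u γ
  Builds-resp-≗ eq (empty z)  = empty (λ i → trans (sym (eq i)) (z i))
  Builds-resp-≗ eq (snoc {p = p} d b) =
    snoc (Descent-resp-≗ p eq d) (Builds-resp-≗ (reflect-cong p eq) b)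

  Builds-length : ∀ {n u β} → Builds n u β → length u ≡ n
  Builds-length (empty _) = refl
  Builds-length (snoc {u = u} {p} _ b) =
    trans (length-++ u) (trans (+-comm (length u) 1) (cong suc (Builds-length b)))

  Builds-0⇒¬Descent : ∀ {u p} {β : Heights k} → Builds 0 u β → ¬ Descent p β
  Builds-0⇒¬Descent {p = p} {β} (empty z) d with subst (β (pred p) <_) (z p) d
  ... | ()

  ≈-snoc : ∀ {u v : Word k} p → u ≈ v → u ++ [ p ] ≈ v ++ [ p ]
  ≈-snoc p e = ++-cong e ≈-refl

  cancel-snoc : ∀ {u v : Word k} {p} w → u ≈ v ++ [ p ] → u ++ p ∷ w ≈ v ++ w
  cancel-snoc {u} {v} {p} w e =
    ≈-trans (++-cong e (≈-refl {u = p ∷ w}))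
    (≈-trans (≡⇒≈ (++-assoc v [ p ] (p ∷ w)))
             (++-cong (≈-refl {u = v}) (++-cong (involution p) (≈-refl {u = w}))))

  commute-snoc : ∀ {p q : I k} (t : Word k) → q ≢ pred p → q ≢ p → pred q ≢ p →
                 (t ++ [ q ]) ++ [ p ] ≈ (t ++ [ p ]) ++ [ q ]
  commute-snoc {p} {q} t a b c =
    ≈-trans (≡⇒≈ (++-assoc t _ _))
    (≈-trans (++-cong (≈-refl {u = t}) (≈-sym (commute p q a b c)))
             (≡⇒≈ (sym (++-assoc t _ _))))

  snoc³ : ∀ (t : Word k) {p q r} → ((t ++ [ p ]) ++ [ q ]) ++ [ r ] ≡ t ++ p ∷ q ∷ r ∷ []
  snoc³ t = trans (cong (_++ _) (++-assoc t _ _)) (++-assoc t _ _)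

  braid-snoc : 2 ≤ k → ∀ (p : I k) (t : Word k) →
               ((t ++ [ pred p ]) ++ [ p ]) ++ [ pred p ] ≈ ((t ++ [ p ]) ++ [ pred p ]) ++ [ p ]
  braid-snoc 2≤k p t =
    ≈-trans (≡⇒≈ (snoc³ t))
    (≈-trans (++-cong (≈-refl {u = t}) (braid 2≤k p)) (≡⇒≈ (sym (snoc³ t))))

  m<n<o⇒m<o∸1 : ∀ {m n o} → m < n → n < o → m < o ∸ 1
  m<n<o⇒m<o∸1 m<n (s≤s n≤o) = ≤-trans m<n n≤o

  m<n<o⇒n∸1<o∸1 : ∀ {m n o} → m < n → n < o → n ∸ 1 < o ∸ 1
  m<n<o⇒n∸1<o∸1 (s≤s _) (s≤s n≤o) = n≤o

  -- For heights a < b < c in columns `pred (pred p)`, `pred p`, `p`, both sides of the braid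
  -- relation descend at every step: (a, b, c), (a, c - 1, b), (c - 2, a, b), (c - 2, b - 1, a) on
  -- one side and (a, b, c), (b - 1, a, c), (b - 1, c - 1, a), (c - 2, b - 1, a) on the other.
  module DoubleDescent (p : I k) {β : Heights k} (d : Descent p β) (e : Descent (pred p) β) where

    2≤k : 2 ≤ k
    -- If `pred (pred p)` were `p`, the two descents would form a strict cycle.
    2≤k = pred²≢id⇒2≤k (λ eq → <-irrefl (cong β eq) (<-trans e d))

    private
      p-2≢p : pred (pred p) ≢ p
      p-2≢p = 2≤k⇒pred²≢id 2≤k p

    pred-after-self : Descent (pred p) (reflect p β)
    pred-after-self = subst₂ _<_
      (sym (reflect-other p β p-2≢p (pred≢id (pred p))))
      (sym (reflect-Descent-pred p β d))
      (m<n<o⇒m<o∸1 e d)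

    self-after-pred : Descent p (reflect (pred p) β)
    self-after-pred = subst₂ _<_
      (sym (reflect-Descent-self (pred p) β e))
      (sym (reflect-other (pred p) β (pred≢id p ∘ sym) (p-2≢p ∘ sym)))
      (<-trans e d)

    self-after-pred-self : Descent p (reflect (pred p) (reflect p β))
    self-after-pred-self = subst₂ _<_
      (sym (trans (reflect-Descent-self (pred p) (reflect p β) pred-after-self)
                  (reflect-other p β p-2≢p (pred≢id (pred p)))))
      (sym (trans (reflect-other (pred p) _ (pred≢id p ∘ sym) (p-2≢p ∘ sym))
                  (reflect-Descent-self p β d)))
      e

    pred-after-self-pred : Descent (pred p) (reflect p (reflect (pred p) β))
    pred-after-self-pred = subst₂ _<_
      (sym (trans (reflect-other p _ p-2≢p (pred≢id (pred p)))
                  (reflect-Descent-pred (pred p) β e)))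
      (sym (trans (reflect-Descent-pred p (reflect (pred p) β) self-after-pred)
                  (cong (_∸ 1) (reflect-other (pred p) β (pred≢id p ∘ sym) (p-2≢p ∘ sym)))))
      (m<n<o⇒n∸1<o∸1 e d)

  -- When the last letter `p` is not `q`, both are descents of `β`, and the relation between them
  -- brings `q` to the end: commutation for non-adjacent letters, braid otherwise. In the braid case
  -- two recursive calls expose the rest of one side of the relation; the second runs on the output
  -- of the first, so only the length decreases.
  exchange : ∀ n {u β} (q : I k) → Builds (suc n) u β → Descent q β →
             ∃[ v ] Builds n v (reflect q β) × u ≈ v ++ [ q ]
  exchange n {β = β} q (snoc {u = u} {p} d b) e with q ≟ p | q ≟ pred p | pred q ≟ p
  ... | yes refl | _ | _ = u , b , ≈-refl
  -- Words of length one or two cannot occur in a braid case: once they are used up the heights are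
  -- zero, yet `DoubleDescent` still provides a descent.
  exchange zero q (snoc d b) e | no _ | yes refl | _ =
    contradiction (DoubleDescent.pred-after-self _ d e) (Builds-0⇒¬Descent b)
  exchange (suc n) q (snoc {p = p} d b) e | no _ | yes refl | _
    with exchange n (pred p) b (DoubleDescent.pred-after-self p d e)
  exchange (suc zero) q (snoc {p = p} d b) e | no _ | yes refl | _ | t , bt , _ =
    contradiction (DoubleDescent.self-after-pred-self p d e) (Builds-0⇒¬Descent bt)
  exchange (suc (suc n)) {β = β} q (snoc {p = p} d b) e | no _ | yes refl | _ | t , bt , u≈
    with exchange n p bt (DoubleDescent.self-after-pred-self p d e)
  ... | t′ , bt′ , t≈ =
    -- The original word is now equivalent to `t′` followed by `p`, `pred p`, `p`. Braiding makes
    -- `pred p`, which is `q`, the last letter, and `reflect-braid` identifies the heights that `t′`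
    -- builds.
    (t′ ++ [ pred p ]) ++ [ p ] ,
    snoc (self-after-pred) (snoc pred-after-self-pred
      (Builds-resp-≗ (λ i → sym (reflect-braid 2≤k p β i)) bt′)) ,
    ≈-trans (≈-snoc p (≈-trans u≈ (≈-snoc (pred p) t≈)))
            (≈-sym (braid-snoc 2≤k p t′))
    where open DoubleDescent p {β} d e
  exchange zero q (snoc d b) e | no _ | no _ | yes refl =
    contradiction (DoubleDescent.self-after-pred q e d) (Builds-0⇒¬Descent b)
  exchange (suc n) q (snoc d b) e | no _ | no _ | yes refl
    with exchange n q b (DoubleDescent.self-after-pred q e d)
  exchange (suc zero) q (snoc d b) e | no _ | no _ | yes refl | t , bt , _ =
    contradiction (DoubleDescent.pred-after-self-pred q e d) (Builds-0⇒¬Descent bt)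
  exchange (suc (suc n)) {β = β} q (snoc d b) e | no _ | no _ | yes refl | t , bt , u≈
    with exchange n (pred q) bt (DoubleDescent.pred-after-self-pred q e d)
  ... | t′ , bt′ , t≈ =
    (t′ ++ [ q ]) ++ [ pred q ] ,
    snoc pred-after-self (snoc self-after-pred-self
      (Builds-resp-≗ (reflect-braid 2≤k q β) bt′)) ,
    ≈-trans (≈-snoc (pred q) (≈-trans u≈ (≈-snoc q t≈)))
            (braid-snoc 2≤k q t′)
    where open DoubleDescent q {β} e d
  exchange n {β = β} q (snoc {p = p} d b) e | no q≢p | no q≢p-1 | no q-1≢p = go n b
    where
    e′ : Descent q (reflect p β)
    e′ = subst₂ _<_ (sym (reflect-other p β q-1≢p (q≢p ∘ pred-injective)))
                    (sym (reflect-other p β q≢p q≢p-1)) e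
    d′ : Descent p (reflect q β)
    d′ = subst₂ _<_ (sym (reflect-other q β (q≢p-1 ∘ sym) (q≢p ∘ sym ∘ pred-injective)))
                    (sym (reflect-other q β (q≢p ∘ sym) (q-1≢p ∘ sym))) d
    go : ∀ n {u} → Builds n u (reflect p β) →
         ∃[ v ] Builds n v (reflect q β) × u ++ [ p ] ≈ v ++ [ q ]
    go zero    b = contradiction e′ (Builds-0⇒¬Descent b)
    go (suc n) b with exchange n q b e′
    ... | t , bt , u≈ =
      t ++ [ p ] ,
      snoc d′ (Builds-resp-≗ (λ i → sym (reflect-commute p q q≢p-1 q≢p q-1≢p β i)) bt) ,
      ≈-trans (≈-snoc p u≈) (commute-snoc t q≢p-1 q≢p q-1≢p)

  Builds-0⇒[] : ∀ {n v β} → β ≗ (λ _ → 0) → Builds n v β → v ≡ []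
  Builds-0⇒[] z (empty _)  = refl
  Builds-0⇒[] z (snoc d b) = contradiction d (Builds-0⇒¬Descent (empty z))

  -- The last letter of the first word is a descent, so `exchange` moves it to the end of the second
  -- word as well, and it can be stripped from both.
  Builds-unique : ∀ {m n u v β} → Builds m u β → Builds n v β → u ≈ v
  Builds-unique (empty z) c = ≡⇒≈ (sym (Builds-0⇒[] z c))
  Builds-unique {n = zero} (snoc d b) c = contradiction d (Builds-0⇒¬Descent c)
  Builds-unique {n = suc n} (snoc {p = p} d b) c with exchange n p c d
  ... | v′ , c′ , v≈ = ≈-trans (≈-snoc p (Builds-unique b c′)) (≈-sym v≈)

  Builds-ascent : ∀ {n u p β} → Builds n u β → Ascent p β → Builds (suc n) (u ++ [ p ]) (reflect p β)
  Builds-ascent {p = p} {β} b a =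
    snoc (Ascent⇒Descent p β a) (Builds-resp-≗ (λ i → sym (reflect-involutive p β i)) b)

  -- A normal form: a letter of `w` that ascends is appended to the building word, and one that
  -- descends cancels against the last letter, where `exchange` has put a copy of it.
  Builds-act : ∀ {n u β} (w : Word k) → Builds n u β →
               ∃[ m ] ∃[ v ] Builds m v (act w β) × u ++ w ≈ v
  Builds-act {n} {u} [] b = n , u , b , ≡⇒≈ (++-identityʳ u)
  Builds-act {n} {u} {β} (p ∷ w) b with β p ≤? β (pred p)
  ... | yes a with Builds-act w (Builds-ascent {p = p} b a)
  ...   | m , v , bv , e = m , v , bv , ≈-trans (≡⇒≈ (sym (++-assoc u [ p ] w))) e
  Builds-act {zero} (p ∷ w) b | no ¬a = contradiction (≰⇒> ¬a) (Builds-0⇒¬Descent b)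
  Builds-act {suc n} {u} (p ∷ w) b | no ¬a with exchange n p b (≰⇒> ¬a)
  ... | u′ , b′ , u≈ with Builds-act w b′
  ...   | m , v , bv , e = m , v , bv , ≈-trans (cancel-snoc w u≈) e

  act-faithful : {u v : Word k} → act u (λ _ → 0) ≗ act v (λ _ → 0) → u ≈ v
  act-faithful {u} {v} eq
    with Builds-act u (empty (λ _ → refl)) | Builds-act v (empty (λ _ → refl))
  ... | _ , _ , b , u≈ | _ , _ , c , v≈ =
    ≈-trans u≈ (≈-trans (Builds-unique b (Builds-resp-≗ (λ i → sym (eq i)) c)) (≈-sym v≈))

  data Ascending : Heights k → Word k → Set where
    []  : ∀ {β} → Ascending β []
    _∷_ : ∀ {β p w} → Ascent p β → Ascending (reflect p β) w → Ascending β (p ∷ w)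

  -- At a descent `exchange` would cancel the next letter against the prefix `u` and give an
  -- equivalent word that is shorter by two.
  Reduced⇒Ascending′ : ∀ {n β} u w → Builds n u β → Reduced (u ++ w) → Ascending β w
  Reduced⇒Ascending′ u [] b red = []
  Reduced⇒Ascending′ {n} {β} u (p ∷ w) b red with β p ≤? β (pred p)
  ... | yes a = a ∷ Reduced⇒Ascending′ (u ++ [ p ]) w (Builds-ascent {p = p} b a)
                      (subst Reduced (sym (++-assoc u [ p ] w)) red)
  Reduced⇒Ascending′ {zero} u (p ∷ w) b red | no ¬a =
    contradiction (≰⇒> ¬a) (Builds-0⇒¬Descent b)
  Reduced⇒Ascending′ {suc n} u (p ∷ w) b red | no ¬a with exchange n p b (≰⇒> ¬a)
  ... | u′ , b′ , u≈ =
    contradiction (red (u′ ++ w) (≈-sym (cancel-snoc w u≈))) (<⇒≱ shorter)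
    where
    shorter : length (u′ ++ w) < length (u ++ p ∷ w)
    shorter = subst₂ _<_
      (sym (trans (length-++ u′) (cong (_+ length w) (Builds-length b′))))
      (sym (trans (length-++ u) (cong (_+ suc (length w)) (Builds-length b))))
      (s≤s (+-monoʳ-≤ n (n≤1+n (length w))))

  Reduced⇒Ascending : {w : Word k} → Reduced w → Ascending (λ _ → 0) w
  Reduced⇒Ascending {w} = Reduced⇒Ascending′ [] w (empty (λ _ → refl))

  -- Fillings and heights

  -- `IsFillingOf` indexed by boxes instead of residues, which agrees because `_⊖ j` is a bijection.
  -- It is stated for plain height functions so that it also applies to the rows above the first.
  Fills : List (Subset (suc k)) → Heights k → Set
  Fills As h = ∀ i j → i ⊖ j ∈ row As j ⇔ j < h i

  IsFillingOf⇒Fills : ∀ {As α} → IsFillingOf As α → Fills As (height α)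
  IsFillingOf⇒Fills {As} {α} fill i j = mk⇔ there′ (λ j<h → ⇐ (fill j (i ⊖ j)) (i , j<h , refl))
    where
    there′ : i ⊖ j ∈ row As j → j < height α i
    there′ m with ⇒ (fill j (i ⊖ j)) m
    ... | i′ , j<h , eq = subst (λ i → j < height α i) (⊖-injective j eq) j<h

  Fills⇒IsFillingOf : ∀ {As α} → Fills As (height α) → IsFillingOf As α
  Fills⇒IsFillingOf {As} {α} fill j p = mk⇔ there′
    (λ (i , j<h , eq) → subst (_∈ row As j) eq (⇐ (fill i j) j<h))
    where
    there′ : p ∈ row As j → ∃[ i ] j < height α i × i ⊖ j ≡ p
    there′ m with ⊖-surjective j p
    ... | i , eq = i , ⇒ (fill i j) (subst (_∈ row As j) (sym eq) m) , eq

  Fills-unique : ∀ {As h h′} → Fills As h → Fills As h′ → h ≗ h′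
  Fills-unique fill fill′ i = ≤-antisym
    (≮⇒≥ (λ lt → <-irrefl refl (⇒ (fill′ i _) (⇐ (fill i _) lt))))
    (≮⇒≥ (λ lt → <-irrefl refl (⇒ (fill i _) (⇐ (fill′ i _) lt))))

  Fills-resp-≗ : ∀ {As h h′} → h ≗ h′ → Fills As h → Fills As h′
  Fills-resp-≗ eq fill i j = mk⇔ (λ m → subst (j <_) (eq i) (⇒ (fill i j) m))
                                 (λ lt → ⇐ (fill i j) (subst (j <_) (sym (eq i)) lt))

  open ListMembership using () renaming (_∈_ to _∈ˡ_; _∉_ to _∉ˡ_)

  -- The heights γ when all letters of a word spelling d_A but the final segment
  -- r have acted: the box that belongs to row 1 of column i is still
  -- missing, and the rows above it sit on column pred i, as long as i is in r.
  record Remaining (h : Heights k) (r : Word k) (γ : Heights k) : Set where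
    field
      pos   : ∀ {i} → i ∈ˡ r → 0 < h i
      moved : ∀ {i} → i ∈ˡ r → pred i ∉ˡ r → h (pred i) ≡ 0
      full  : ∀ {i} → i ∈ˡ r → γ (pred i) ≡ h i ∸ 1
      gap   : ∀ {i} → i ∉ˡ r → pred i ∈ˡ r → γ (pred i) ≡ 0
      done  : ∀ {i} → i ∉ˡ r → pred i ∉ˡ r → γ (pred i) ≡ h (pred i)

  open Remaining

  -- By the cyclically decreasing order the letter `next p` can no longer follow `p`, so column `p`
  -- is empty when `p` acts. The column of height `h p ∸ 1` on `pred p` then moves over to `p` and
  -- gains its missing bottom box.
  Remaining-act : ∀ {h r γ} → AllPairs (λ a b → a ≢ b × a ≢ pred b) r →
                  Remaining h r γ → act r γ ≗ h
  Remaining-act {h} {[]} {γ} [] R i =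
    subst (λ i → γ i ≡ h i) (pred-next i) (done R {next i} (λ ()) (λ ()))
  Remaining-act {h} {p ∷ r} {γ} (p# ∷ r#) R = Remaining-act r# R′
    where
    p∉r : p ∉ˡ r
    p∉r p∈r = proj₁ (All.lookup p# p∈r) refl

    drop : ∀ {i} → i ∉ˡ r → i ≢ p → i ∉ˡ p ∷ r
    drop i∉r i≢p (here eq)   = i≢p eq
    drop i∉r i≢p (there i∈r) = i∉r i∈r

    pred∈r⇒≢p : ∀ {i} → i ∈ˡ r → pred i ≢ p
    pred∈r⇒≢p i∈r eq = proj₂ (All.lookup p# i∈r) (sym eq)

    γ-p : γ p ≡ 0
    γ-p = subst (λ i → γ i ≡ 0) (pred-next p)
      (gap R {next p} (drop (λ m → pred∈r⇒≢p m (pred-next p)) (λ eq →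
               pred≢id p (trans (cong pred (sym eq)) (pred-next p))))
             (here (pred-next p)))

    ascent : Ascent p γ
    ascent = subst (_≤ γ (pred p)) (sym γ-p) z≤n

    at-p : reflect p γ p ≡ h p
    -- Positivity of `h p` makes the truncated subtraction in `full` exact.
    at-p with h p | pos R (here refl) | full R (here refl)
    ... | suc n | _ | eq = trans (reflect-Ascent-self p γ ascent) (cong suc eq)

    at-pred : reflect p γ (pred p) ≡ 0
    at-pred = trans (reflect-Ascent-pred p γ ascent) γ-p

    off : ∀ {i} → pred i ≢ p → i ≢ p → reflect p γ (pred i) ≡ γ (pred i)
    off a b = reflect-other p γ a (b ∘ pred-injective)

    ∈r⇒≢p : ∀ {i} → i ∈ˡ r → i ≢ p
    ∈r⇒≢p i∈r refl = p∉r i∈r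

    R′ : Remaining h r (reflect p γ)
    R′ .pos   i∈r         = pos R (there i∈r)
    -- The letter `pred i` never precedes `i`, so dropping `p` cannot make `pred i` newly absent.
    R′ .moved i∈r i-1∉r   = moved R (there i∈r) (drop i-1∉r (pred∈r⇒≢p i∈r))
    R′ .full  i∈r         = trans (off (pred∈r⇒≢p i∈r) (∈r⇒≢p i∈r)) (full R (there i∈r))
    R′ .gap {i} i∉r i-1∈r with i ≟ p
    ... | yes refl = at-pred
    ... | no i≢p   = trans (off (∈r⇒≢p i-1∈r) i≢p) (gap R (drop i∉r i≢p) (there i-1∈r))
    R′ .done {i} i∉r i-1∉r with i ≟ p | pred i ≟ p
    ... | yes refl | _       = trans at-pred (sym (moved R (here refl) (drop i-1∉r (pred≢id p))))
    ... | no i≢p   | yes eq  = subst (λ j → reflect p γ j ≡ h j) (sym eq) at-p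
    ... | no i≢p   | no i-1≢p = trans (off i-1≢p i≢p) (done R (drop i∉r i≢p) (drop i-1∉r i-1≢p))

  -- The word of the upper rows comes first and, by induction, produces their heights; the word of
  -- the first row then slides the columns into place, by `Remaining-act`.
  act-SpellsProduct : ∀ {As w h} → SpellsProduct As w → Fills As h → act w (λ _ → 0) ≗ h
  act-SpellsProduct {h = h} [] fill i with h i | ⇐ (fill i 0)
  ... | zero  | _ = refl
  ... | suc _ | f = contradiction (f (s≤s z≤n)) ∉⊥
  act-SpellsProduct {A ∷ As} {h = h} (_∷_ {u = u} {v} (dec , iff) sp) fill i =
    trans (cong (λ f → f i) (act-++ v u (λ _ → 0)))
    (trans (act-cong u (act-SpellsProduct sp tail) i) (Remaining-act dec start i))
    where
    -- Since `i ⊖ suc j` is `pred i ⊖ j`, the rows above the first, read as a filling of their own,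
    -- hold column `i` in column `pred i` with one box less.
    lower : Heights k
    lower c = h (next c) ∸ 1

    tail : Fills As lower
    tail c j = subst (λ i → i ⊖ j ∈ row As j ⇔ j < lower c) (pred-next c)
      (mk⇔ (λ m → pred-< (⇒ (fill (next c) (suc j)) m))
           (λ lt → ⇐ (fill (next c) (suc j)) (<-pred lt)))
      where
      pred-< : ∀ {n} → suc j < n → j < n ∸ 1
      pred-< (s≤s lt) = lt
      <-pred : ∀ {n} → j < n ∸ 1 → suc j < n
      <-pred {suc n} lt = s≤s lt

    lower-pred : ∀ i → lower (pred i) ≡ h i ∸ 1
    lower-pred i = cong (λ i → h i ∸ 1) (next-pred i)

    ∉⇒0 : ∀ {i} → i ∉ˡ u → h i ≡ 0
    ∉⇒0 {i} i∉u with h i | ⇐ (fill i 0)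
    ... | zero  | _ = refl
    ... | suc _ | f = contradiction (⇐ (iff i) (f (s≤s z≤n))) i∉u

    start : Remaining h u lower
    start .pos {i} i∈u    = ⇒ (fill i 0) (⇒ (iff i) i∈u)
    start .moved _ i-1∉u  = ∉⇒0 i-1∉u
    start .full {i} _     = lower-pred i
    start .gap {i} i∉u _  = trans (lower-pred i) (cong (_∸ 1) (∉⇒0 i∉u))
    start .done {i} i∉u i-1∉u =
      trans (trans (lower-pred i) (cong (_∸ 1) (∉⇒0 i∉u))) (sym (∉⇒0 i-1∉u))

  -- Insertion on columns

  -- The boolean comparison computes on successors, so removing the bottom row preserves the
  -- condition definitionally.
  Column : (ℕ → Maybe ℕ) → ℕ → Set
  Column c h = ∀ j → is-just (c j) ≡ (j <ᵇ h)

  Column-tail : ∀ {c} h → Column c h → Column (c ∘ suc) (h ∸ 1)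
  Column-tail zero    C j = C (suc j)
  Column-tail (suc h) C j = C (suc j)

  -- Here a is the height of column pred p; its boxes higher than column p slide
  -- over to column p, and the box labelled ℓ is put on top of them.
  record Inserted (ℓ : ℕ) (p : I k) (a : ℕ) (S T : Tableau k) : Set where
    field
      others : ∀ i j → i ≢ p → i ≢ pred p → T (i , j) ≡ S (i , j)
      source : ∀ j → T (pred p , j) ≡ (if is-just (S (p , j)) then S (pred p , j) else nothing)
      target : ∀ j → T (p , j) ≡
                 (S (p , j) <∣> S (pred p , j) <∣> (if j ≡ᵇ a then just ℓ else nothing))

  open Inserted

  Inserted-resp-≗ : ∀ {ℓ p a S S′ T} → S ≗ S′ → Inserted ℓ p a S T → Inserted ℓ p a S′ T
  Inserted-resp-≗ eq N .others i j x y = trans (others N i j x y) (eq (i , j))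
  Inserted-resp-≗ {p = p} eq N .source j =
    trans (source N j) (cong₂ (λ x y → if is-just x then y else nothing) (eq (p , j)) (eq (pred p , j)))
  Inserted-resp-≗ {p = p} eq N .target j =
    trans (target N j) (cong₂ (λ x y → x <∣> y <∣> _) (eq (p , j)) (eq (pred p , j)))

  nothing⇒height≡0 : ∀ {c h} → Column c h → c 0 ≡ nothing → h ≡ 0
  nothing⇒height≡0 {h = zero}  C eq = refl
  nothing⇒height≡0 {h = suc h} C eq with trans (sym (C 0)) (cong is-just eq)
  ... | ()

  Column-≥ : ∀ {c h} → Column c h → ∀ {j} → h ≤ j → c j ≡ nothing
  Column-≥ {c} {h} C {j} h≤j with c j | trans (C j) (≥⇒≮ᵇ h≤j)
    where
    ≥⇒≮ᵇ : ∀ {h j} → h ≤ j → (j <ᵇ h) ≡ false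
    ≥⇒≮ᵇ z≤n       = refl
    ≥⇒≮ᵇ (s≤s h≤j) = ≥⇒≮ᵇ h≤j
  ... | nothing | _ = refl

  column : LabelledFilling k → I k → ℕ → Maybe ℕ
  column F i j = labels F (i , j)

  include : ∀ ℓ p A F → Column (column (A ∷ F) (pred p)) 0 → Column (column (A ∷ F) p) 0 →
            Inserted ℓ p 0 (labels (A ∷ F)) (labels ((A [ p ]≔ just ℓ) ∷ F))
  include ℓ p A F Ca Cb .others i zero    i≢p _ = lookup∘update′ i≢p A (just ℓ)
  include ℓ p A F Ca Cb .others i (suc j) _   _ = refl
  include ℓ p A F Ca Cb .source zero
    rewrite Column-≥ Cb {0} z≤n = trans (lookup∘update′ (pred≢id p) A (just ℓ)) (Column-≥ Ca {0} z≤n)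
  include ℓ p A F Ca Cb .source (suc j)
    rewrite Column-≥ Cb {suc j} z≤n = Column-≥ Ca {suc j} z≤n
  include ℓ p A F Ca Cb .target zero
    rewrite Column-≥ Cb {0} z≤n | Column-≥ Ca {0} z≤n = lookup∘update p A (just ℓ)
  include ℓ p A F Ca Cb .target (suc j)
    rewrite Column-≥ Cb {suc j} z≤n | Column-≥ Ca {suc j} z≤n = refl

  -- Lets insertion into the empty filling be handled as inclusion into an empty row.
  labels-∅∷[] : labels (∅ ∷ []) ≗ labels {k} []
  labels-∅∷[] (i , zero)  = refl
  labels-∅∷[] (i , suc j) = refl

  -- Passing to the next row with residue `pred p` stays on the same two columns of the cylinder.
  -- Going up, the move is Braid while both columns have a box, Bump while only column `pred p` has
  -- one, and Inclusion at height `a`. The zero case would need column `p` to be the higher one,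
  -- against `b ≤ a`.
  insert-Column : ∀ ℓ p F {a b} → Column (column F (pred p)) a → Column (column F p) b → b ≤ a →
                  ∃[ F′ ] insert ℓ p F ≡ just F′ × Inserted ℓ p a (labels F) (labels F′)
  insert-Column ℓ p [] {a} {b} Ca Cb b≤a
    with refl ← nothing⇒height≡0 {h = a} Ca (lookup-replicate (pred p) nothing)
       | refl ← nothing⇒height≡0 {h = b} Cb (lookup-replicate p nothing) =
    _ , refl , Inserted-resp-≗ labels-∅∷[]
      (include ℓ p ∅ [] (λ j → trans (cong is-just (labels-∅∷[] (pred p , j))) (Ca j))
                        (λ j → trans (cong is-just (labels-∅∷[] (p , j))) (Cb j)))
  insert-Column ℓ p (A ∷ F) {a} {b} Ca Cb b≤a
    with lookup A p in eqp | lookup A (pred p) in eqq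
  ... | nothing | nothing
    with refl ← nothing⇒height≡0 {h = a} Ca eqq | refl ← nothing⇒height≡0 {h = b} Cb eqp =
    _ , refl , include ℓ p A F Ca Cb
  insert-Column ℓ p (A ∷ F) {zero}  {b} Ca Cb b≤a | _ | just m
    with trans (sym (Ca 0)) (cong is-just eqq)
  ... | ()
  insert-Column ℓ p (A ∷ F) {zero}  {suc b} Ca Cb () | just _ | nothing
  insert-Column ℓ p (A ∷ F) {zero}  {zero} Ca Cb b≤a | just _ | nothing
    with trans (sym (Cb 0)) (cong is-just eqp)
  ... | ()
  insert-Column ℓ p (A ∷ F) {suc a} {b} Ca Cb b≤a | just _ | nothing
    with trans (sym (Ca 0)) (cong is-just eqq)
  ... | ()
  insert-Column ℓ p (A ∷ F) {suc a} {b} Ca Cb b≤a | nothing | just m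
    with refl ← nothing⇒height≡0 {h = b} Cb eqp
    with insert-Column ℓ (pred p) F {a} {0} (Column-tail (suc a) Ca) (Column-tail 0 Cb) z≤n
  ... | F′ , eq , N rewrite eq = A′ ∷ F′ , refl , N′
    where
    A′ : LabelledRow k
    A′ = (A [ pred p ]≔ nothing) [ p ]≔ just m
    N′ : Inserted ℓ p (suc a) (labels (A ∷ F)) (labels (A′ ∷ F′))
    N′ .others i zero    i≢p i≢p-1 =
      trans (lookup∘update′ i≢p (A [ pred p ]≔ nothing) (just m)) (lookup∘update′ i≢p-1 A nothing)
    N′ .others i (suc j) i≢p i≢p-1 =
      others N (pred i) j (i≢p ∘ pred-injective) (i≢p-1 ∘ pred-injective)
    N′ .source zero =
      trans (lookup∘update′ (pred≢id p) (A [ pred p ]≔ nothing) (just m))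
      (trans (lookup∘update (pred p) A nothing)
             (cong (λ x → if is-just x then lookup A (pred p) else nothing) (sym eqp)))
    N′ .source (suc j) = source N j
    N′ .target zero =
      trans (lookup∘update p (A [ pred p ]≔ nothing) (just m))
            (cong₂ (λ x y → x <∣> y <∣> nothing) (sym eqp) (sym eqq))
    N′ .target (suc j) = target N j
  insert-Column ℓ p (A ∷ F) {suc a} {b} Ca Cb b≤a | just _ | just m
    with insert-Column ℓ (pred p) F {a} {b ∸ 1} (Column-tail (suc a) Ca) (Column-tail b Cb)
                       (∸-monoˡ-≤ 1 b≤a)
  ... | F′ , eq , N rewrite eq = A ∷ F′ , refl , N′
    where
    N′ : Inserted ℓ p (suc a) (labels (A ∷ F)) (labels (A ∷ F′))
    N′ .others i zero    i≢p i≢p-1 = refl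
    N′ .others i (suc j) i≢p i≢p-1 =
      others N (pred i) j (i≢p ∘ pred-injective) (i≢p-1 ∘ pred-injective)
    N′ .source zero rewrite eqp = refl
    N′ .source (suc j) = source N j
    N′ .target zero rewrite eqp = refl
    N′ .target (suc j) = target N j

  -- The invariant of inserting a word: `ℓ` is the next label to be given, so each new label exceeds
  -- all those present.
  record Standing (ℓ : ℕ) (β : Heights k) (T : Tableau k) : Set where
    field
      columns : ∀ i → Column (λ j → T (i , j)) (β i)
      bounded : ∀ i j {m} → T (i , j) ≡ just m → m < ℓ

  open Standing

  is-just-if : ∀ {x y : Maybe ℕ} {a b} j → b ≤ a → is-just x ≡ (j <ᵇ b) → is-just y ≡ (j <ᵇ a) →
               is-just (if is-just x then y else nothing) ≡ (j <ᵇ b)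
  is-just-if {nothing} j b≤a eqx eqy = eqx
  is-just-if {just _} {y} {a} {b} j b≤a eqx eqy =
    trans eqy (trans (⇒ T-≡ (<⇒<ᵇ (<-≤-trans (<ᵇ⇒< j b (⇐ T-≡ (sym eqx))) b≤a))) eqx)

  is-just-<∣> : ∀ {x y : Maybe ℕ} {a b ℓ} j → b ≤ a → is-just x ≡ (j <ᵇ b) → is-just y ≡ (j <ᵇ a) →
                is-just (x <∣> y <∣> (if j ≡ᵇ a then just ℓ else nothing)) ≡ (j <ᵇ suc a)
  is-just-<∣> {just _} {y} {a} {b} j b≤a eqx eqy =
    sym (⇒ T-≡ (<⇒<ᵇ (m<n⇒m<1+n (<-≤-trans (<ᵇ⇒< j b (⇐ T-≡ (sym eqx))) b≤a))))
  is-just-<∣> {nothing} {just _} {a} j b≤a eqx eqy =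
    sym (⇒ T-≡ (<⇒<ᵇ (m<n⇒m<1+n (<ᵇ⇒< j a (⇐ T-≡ (sym eqy))))))
  is-just-<∣> {nothing} {nothing} {a} j b≤a eqx eqy = last j a (sym eqy)
    where
    last : ∀ j a {ℓ : ℕ} → (j <ᵇ a) ≡ false →
           is-just (if j ≡ᵇ a then just ℓ else nothing) ≡ (j <ᵇ suc a)
    last zero    zero    eq = refl
    last (suc j) zero    eq = refl
    last (suc j) (suc a) eq = last j a eq

  module _ {ℓ p β S T} (std : Standing ℓ β S) (asc : Ascent p β)
           (N : Inserted ℓ p (β (pred p)) S T) where

    Inserted-Standing : Standing (suc ℓ) (reflect p β) T
    Inserted-Standing .columns i j with position p i
    ... | self refl = trans (cong is-just (target N j))
      (trans (is-just-<∣> {S (p , j)} j asc (columns std p j) (columns std (pred p) j))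
             (cong (j <ᵇ_) (sym (reflect-Ascent-self p β asc))))
    ... | left refl = trans (cong is-just (source N j))
      (trans (is-just-if {S (p , j)} j asc (columns std p j) (columns std (pred p) j))
             (cong (j <ᵇ_) (sym (reflect-Ascent-pred p β asc))))
    ... | away a b = trans (cong is-just (others N i j a b))
      (trans (columns std i j) (cong (j <ᵇ_) (sym (reflect-other p β a b))))
    Inserted-Standing .bounded i j {m} eq with position p i
    ... | away a b = m<n⇒m<1+n (bounded std i j (trans (sym (others N i j a b)) eq))
    ... | left refl with S (p , j) | S (pred p , j) in eqq | source N j
    ...   | just _ | _ | src = m<n⇒m<1+n (bounded std (pred p) j (trans eqq (trans (sym src) eq)))
    ...   | nothing | _ | src with trans (sym src) eq
    ...     | ()
    Inserted-Standing .bounded i j {m} eq | self refl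
      with S (p , j) in eqp | S (pred p , j) in eqq | j ≡ᵇ β (pred p) | target N j
    ... | just _ | _ | _ | tgt = m<n⇒m<1+n (bounded std p j (trans eqp (trans (sym tgt) eq)))
    ... | nothing | just _ | _ | tgt = m<n⇒m<1+n (bounded std (pred p) j (trans eqq (trans (sym tgt) eq)))
    ... | nothing | nothing | true | tgt with refl ← trans (sym tgt) eq = ≤-refl
    Inserted-Standing .bounded i j {m} eq | self refl | nothing | nothing | false | tgt
      with trans (sym tgt) eq
    ... | ()

    new-label : T (p , β (pred p)) ≡ just ℓ
    new-label
      rewrite target N (β (pred p)) | Column-≥ (columns std p) asc
            | Column-≥ {h = β (pred p)} (columns std (pred p)) ≤-refl
            | ⇒ T-≡ (≡⇒≡ᵇ (β (pred p)) (β (pred p)) refl) = refl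

    -- Every label outside column `p` was present before the insertion and is therefore less than
    -- `ℓ`.
    new-label-column : ∀ i j → T (i , j) ≡ just ℓ → i ≡ p
    new-label-column i j eq with position p i
    ... | self i≡p = i≡p
    ... | away a b =
      contradiction (bounded std i j (trans (sym (others N i j a b)) eq)) (<-irrefl refl)
    ... | left refl with is-just (S (p , j)) | trans (sym (source N j)) eq
    ...   | true | eq′ = contradiction (bounded std (pred p) j eq′) (<-irrefl refl)

  -- Undoing an insertion on the labels

  module _ {ℓ : ℕ} where

    source′ : Maybe ℕ → Maybe ℕ → Maybe ℕ
    source′ x y = if is-just x then y else nothing

    target′ : Maybe ℕ → Maybe ℕ → Bool → Maybe ℕ
    target′ x y f = x <∣> y <∣> (if f then just ℓ else nothing)

    -- In one row, a label left in the source column means that nothing slid. Otherwise the target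
    -- held no box, and its label came from the source column unless it is `ℓ`, which no old label
    -- equals. The flags are independent because the two heights are not yet known to agree.
    cell-injective : ∀ {x y x′ y′} f f′ →
      (is-just x ≡ true → is-just y ≡ true) → (is-just x′ ≡ true → is-just y′ ≡ true) →
      y ≢ just ℓ → y′ ≢ just ℓ →
      source′ x y ≡ source′ x′ y′ → target′ x y f ≡ target′ x′ y′ f′ → x ≡ x′ × y ≡ y′
    cell-injective {just _} {nothing} f f′ n n′ y# y′# s t = contradiction (n refl) λ ()
    cell-injective {x′ = just _} {nothing} f f′ n n′ y# y′# s t = contradiction (n′ refl) λ ()
    cell-injective {just _} {just _} {just _} {just _} f f′ n n′ y# y′# s t = t , s
    cell-injective {nothing} {just _} {nothing} {just _} f f′ n n′ y# y′# s t = refl , t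
    cell-injective {nothing} {just _} {nothing} {nothing} f true n n′ y# y′# s t = contradiction t y#
    cell-injective {nothing} {nothing} {nothing} {just _} true f′ n n′ y# y′# s t = contradiction (sym t) y′#
    cell-injective {nothing} {nothing} {nothing} {nothing} f f′ n n′ y# y′# s t = refl , refl

  nested : ∀ {c d a b} → Column d a → Column c b → b ≤ a →
           ∀ j → is-just (c j) ≡ true → is-just (d j) ≡ true
  nested {a = a} {b} Cd Cc b≤a j eq =
    trans (Cd j) (⇒ T-≡ (<⇒<ᵇ (<-≤-trans (<ᵇ⇒< j b (⇐ T-≡ (trans (sym (Cc j)) eq))) b≤a)))

  Inserted-injective : ∀ {ℓ p p′ β β′ S S′ T T′} → Standing ℓ β S → Standing ℓ β′ S′ →
    Ascent p β → Ascent p′ β′ → Inserted ℓ p (β (pred p)) S T → Inserted ℓ p′ (β′ (pred p′)) S′ T′ →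
    T ≗ T′ → p ≡ p′ × S ≗ S′
  Inserted-injective {ℓ} {p} {p′} {β} {β′} {S} {S′} {T} {T′} std std′ asc asc′ N N′ T≗T′
    -- `T` has the label `ℓ` in column `p`, hence so does `T′`, whose only column with this label is
    -- `p′`.
    with refl ← new-label-column std′ asc′ N′ p (β (pred p))
                  (trans (sym (T≗T′ (p , β (pred p)))) (new-label std asc N)) =
    refl , S≗S′
    where
    cells : ∀ j → S (p , j) ≡ S′ (p , j) × S (pred p , j) ≡ S′ (pred p , j)
    cells j = cell-injective (j ≡ᵇ β (pred p)) (j ≡ᵇ β′ (pred p))
      (nested (columns std (pred p)) (columns std p) asc j)
      (nested (columns std′ (pred p)) (columns std′ p) asc′ j)
      (λ eq → <-irrefl refl (bounded std (pred p) j eq))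
      (λ eq → <-irrefl refl (bounded std′ (pred p) j eq))
      (trans (sym (source N j)) (trans (T≗T′ (pred p , j)) (source N′ j)))
      (trans (sym (target N j)) (trans (T≗T′ (p , j)) (target N′ j)))
    S≗S′ : S ≗ S′
    S≗S′ (i , j) with position p i
    ... | self refl = proj₁ (cells j)
    ... | left refl = proj₂ (cells j)
    ... | away a b  = trans (sym (others N i j a b)) (trans (T≗T′ (i , j)) (others N′ i j a b))

  insertWord-Standing : ∀ {ℓ β F} w → Standing ℓ β (labels F) → Ascending β w →
    ∃[ R ] insertWord ℓ w F ≡ just R × (∃[ ℓ′ ] Standing ℓ′ (act w β) (labels R))
  insertWord-Standing {ℓ} {F = F} [] std [] = F , refl , ℓ , std
  insertWord-Standing {ℓ} {F = F} (p ∷ w) std (asc ∷ ascs)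
    with insert-Column ℓ p F (columns std (pred p)) (columns std p) asc
  ... | F′ , eq , N rewrite eq = insertWord-Standing w (Inserted-Standing std asc N) ascs

  -- Undoing starts at the last letter, so the recursive call treats the later letters first and
  -- returns the agreement of the labels just after the first letter. For this the two runs must be
  -- allowed different starting fillings, and the conclusion must identify them.
  insertWord-injective : ∀ {ℓ β β′ F F′ R R′} w w′ → length w ≡ length w′ →
    Standing ℓ β (labels F) → Standing ℓ β′ (labels F′) → Ascending β w → Ascending β′ w′ →
    insertWord ℓ w F ≡ just R → insertWord ℓ w′ F′ ≡ just R′ → labels R ≗ labels R′ →
    w ≡ w′ × labels F ≗ labels F′
  insertWord-injective [] [] _ _ _ _ _ refl refl eq = refl , eq
  insertWord-injective {ℓ} {F = F} {F′} (p ∷ w) (p′ ∷ w′) len std std′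
                       (asc ∷ ascs) (asc′ ∷ ascs′) run run′ eq
    with insert-Column ℓ p F (columns std (pred p)) (columns std p) asc
       | insert-Column ℓ p′ F′ (columns std′ (pred p′)) (columns std′ p′) asc′
  ... | G , eqG , N | G′ , eqG′ , N′ rewrite eqG | eqG′
    with refl , labels≗ ← insertWord-injective w w′ (suc-injective len)
           (Inserted-Standing std asc N) (Inserted-Standing std′ asc′ N′) ascs ascs′ run run′ eq
    with refl , S≗S′ ← Inserted-injective std std′ asc asc′ N N′ labels≗ = refl , S≗S′

  -- Reduced words, their codes and recording tableaux

  Standing-[] : Standing 1 (λ _ → 0) (labels [])
  Standing-[] .columns i j rewrite lookup-replicate (i ⊖ j) (nothing {A = ℕ}) = refl
  Standing-[] .bounded i j eq with trans (sym (lookup-replicate (i ⊖ j) nothing)) eq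
  ... | ()

  insertion-Standing : ∀ {w} → Reduced w →
    ∃[ R ] insertion w ≡ just R × (∃[ ℓ ] Standing ℓ (act w (λ _ → 0)) (labels R))
  insertion-Standing {w} red = insertWord-Standing w Standing-[] (Reduced⇒Ascending red)

  lookup-row : ∀ (F : LabelledFilling k) j p →
               lookup (row (residues F) j) p ≡ is-just (lookup (labelledRow F j) p)
  lookup-row []      j       p =
    trans (lookup-replicate p false) (cong is-just (sym (lookup-replicate p nothing)))
  lookup-row (A ∷ F) zero    p = lookup-map p is-just A
  lookup-row (A ∷ F) (suc j) p = lookup-row F j p

  Standing⇒Fills : ∀ {ℓ β} F → Standing ℓ β (labels F) → Fills (residues F) β
  Standing⇒Fills {β = β} F std i j = mk⇔
    (λ m → <ᵇ⇒< j (β i) (⇐ T-≡ (trans (sym present) ([]=⇒lookup m))))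
    (λ lt → lookup⇒[]= (i ⊖ j) _ (trans present (⇒ T-≡ (<⇒<ᵇ lt))))
    where
    present : lookup (row (residues F) j) (i ⊖ j) ≡ (j <ᵇ β i)
    present = trans (lookup-row F j (i ⊖ j)) (columns std i j)

  Q-insertion : ∀ w {R} → insertion w ≡ just R → labels R ≗ Q {k} w
  Q-insertion w eq c rewrite eq = refl

  Q-injective : ∀ {w w′} → Reduced w → Reduced w′ → w ≈ w′ → Q {k} w ≗ Q w′ → w ≡ w′
  Q-injective {w} {w′} red red′ e eq with insertion-Standing red | insertion-Standing red′
  ... | R , run , _ | R′ , run′ , _ = proj₁ (insertWord-injective w w′
    -- Reduced words of the same element have the same length.
    (≤-antisym (red w′ (≈-sym e)) (red′ w e)) Standing-[] Standing-[]
    (Reduced⇒Ascending red) (Reduced⇒Ascending red′) run run′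
    (λ c → trans (Q-insertion w run c) (trans (eq c) (sym (Q-insertion w′ run′ c)))))

  Reduced-InsertsTo : ∀ {w α} → Reduced w → act w (λ _ → 0) ≗ height α → InsertsTo w α
  Reduced-InsertsTo {w} {α} red eq with insertion-Standing red
  ... | R , run , _ , std =
    R , run , Fills⇒IsFillingOf {residues R} {α} (Fills-resp-≗ {residues R} eq (Standing⇒Fills R std))

  InsertsTo⇒act : ∀ {w α} → Reduced w → InsertsTo w α → act w (λ _ → 0) ≗ height α
  InsertsTo⇒act {w} {α} red (F , run′ , fill) with insertion-Standing red
  ... | R , run , _ , std with refl ← trans (sym run) run′ =
    Fills-unique {residues R} (Standing⇒Fills R std) (IsFillingOf⇒Fills {residues R} {α} fill)

  IsCodeOf⇒act : ∀ {x α} → IsCodeOf α x → act x (λ _ → 0) ≗ height α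
  IsCodeOf⇒act {x} {α} (As , ((_ , w , sp , w≈x , _) , _) , fill) i =
    trans (act-resp-≈ (≈-sym w≈x) (λ _ → 0) i)
          (act-SpellsProduct sp (IsFillingOf⇒Fills {As} {α} fill) i)

theorem29 : (k : ℕ) .{{_ : NonZero k}} (x : AffinePermutation k) (α : Code k) → IsCodeOf α x →
    Σ[ f ∈ Bijection (ReducedWords x) (RecordingTableaux α) ]
    (∀ w → proj₁ (Bijection.to f w) ≗ Q (proj₁ w))
theorem29 k x α code = record
  { to        = λ (w , w≈x , red) → Q w , w , red ,
                  Reduced-InsertsTo {α = α} red (λ i → trans (act-resp-≈ w≈x (λ _ → 0) i) (code-x i)) ,
                  (λ _ → refl)
  ; cong      = λ { refl _ → refl }
  ; bijective =
      (λ { {w , w≈x , red} {w′ , w′≈x , red′} → Q-injective red red′ (≈-trans w≈x (≈-sym w′≈x)) }) ,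
      -- A reduced word with insertion `α` sends the zero heights to `height α`, as `x` does, so
      -- faithfulness makes it a word for `x`.
      (λ (T , w , red , ins , T≗Q) →
        (w , act-faithful (λ i → trans (InsertsTo⇒act {α = α} red ins i) (sym (code-x i))) , red) ,
        λ { refl c → sym (T≗Q c) })
  } , λ _ _ → refl
  where
  code-x : act x (λ _ → 0) ≗ height α
  code-x = IsCodeOf⇒act {α = α} code
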